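{- Let $t\geq 2$ be a fixed integer and let $P$ be a finite poset with the unique cover twin property (UCTP) having at least $2$ elements. Then $\mathrm{sat}^{\star}([t]^n,P)=\Omega(\sqrt{n})$ as $n\to\infty$.
   Context: For positive integers $n,t$, $[n]=\{1,\dots,n\}$ and the hypergrid $[t]^n$ is the set of functions $f:[n]\to[t]$, partially ordered by $f\leq g$ iff $f(i)\leq g(i)$ for all $i\in[n]$. An induced copy of a poset $P$ in a family $\mathcal{F}\subseteq[t]^n$ is an injective map $\phi:P\to\mathcal{F}$ such that $\phi(x)\leq\phi(y)$ iff $x\leq_P y$. A family $\mathcal{F}\subseteq[t]^n$ is induced $P$-free if it contains no induced copy of $P$; it is induced $P$-saturated if it is induced $P$-free and for every $f\in[t]^n\setminus\mathcal{F}$ the family $\mathcal{F}\cup\{f\}$ contains an induced copy of $P$. Whenever $P$ embeds as an induced subposet of $[t]^n$, $\mathrm{sat}^{\star}([t]^n,P)$ denotes the minimum size of an induced $P$-saturated family in $[t]^n$. In a poset $P$, an element $x$ covers an element $y\neq x$ if $y\leq_P x$ and there is no $z\in P\setminus\{x,y\}$ with $y\leq_P z\leq_P x$. $P$ has the UCTP if whenever $x$ covers $y$, there exists $y'\in P\setminus\{x,y\}$ such that $x$ covers $y'$. -}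

module Defs where

open import Level using (0ℓ)
open import Data.Nat using (ℕ; zero; suc; _+_; _*_; _^_; _≤_; _<_; z≤n; s≤s; NonZero)
import Data.Nat.Properties as ℕ
open import Data.Fin as Fin using (Fin; finToFun; funToFin)
open import Data.Fin.Properties using (_≟_; any?; all?; finToFun-funToFin)
open import Data.Fin.Subset using (Subset; _∈_; _∉_; _∪_; ⁅_⁆; ∣_∣; ⊥)
open import Data.Fin.Subset.Properties using (_∈?_; anySubset?; ∣p∣≤n; p⊂q⇒∣p∣<∣q∣; p⊆p∪q; q⊆p∪q; x∈⁅x⁆; ∉⊥)
open import Data.Product using (∃-syntax; _×_; _,_)
open import Data.Empty using (⊥-elim)
open import Function using (_∘_)
open import Function.Bundles using (_⇔_; mk⇔; module Equivalence)
open import Function.Definitions using (Injective)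
open import Relation.Binary using (Rel; IsDecPartialOrder)
open import Relation.Binary.PropositionalEquality using (_≡_; _≢_; _≗_; refl; sym; trans; subst; subst₂)
open import Relation.Nullary using (¬_; Dec; yes; no)
open import Relation.Nullary.Decidable using (map′; ¬?; _×-dec_; _→-dec_; decidable-stable)

-- Every finite poset is, up to isomorphism, a partial order on some Fin k.
-- Decidability of the order is automatic classically.
record FinPoset (k : ℕ) : Set₁ where
  infix 4 _⊑_
  field
    _⊑_               : Rel (Fin k) 0ℓ
    isDecPartialOrder : IsDecPartialOrder _≡_ _⊑_
  open IsDecPartialOrder isDecPartialOrder public
    using () renaming (_≤?_ to _⊑?_)

module _ {k : ℕ} (P : FinPoset k) where
  open FinPoset P

  Covers : Fin k → Fin k → Set
  Covers x y = x ≢ y × y ⊑ x × ¬ (∃[ z ] z ≢ x × z ≢ y × y ⊑ z × z ⊑ x)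

  UCTP : Set
  UCTP = ∀ x y → Covers x y → ∃[ y′ ] y′ ≢ x × y′ ≢ y × Covers x y′

-- The set of functions Fin n → Fin t, with Fin t = {0, …, t-1} in place of
-- {1, …, t}, coded through the bijection finToFun / funToFin.  With codes,
-- equality of functions is _≡_ and families are the library's subsets.
Hypergrid : ℕ → ℕ → Set
Hypergrid t n = Fin (t ^ n)

module _ {t n : ℕ} where

  _⟨_⟩ : Hypergrid t n → Fin n → Fin t
  f ⟨ i ⟩ = finToFun {t} {n} f i

  infix 4 _≤ᴴ_
  _≤ᴴ_ : Hypergrid t n → Hypergrid t n → Set
  f ≤ᴴ g = ∀ i → f ⟨ i ⟩ Fin.≤ g ⟨ i ⟩

Family : ℕ → ℕ → Set
Family t n = Subset (t ^ n)

module _ {k : ℕ} (P : FinPoset k) {t n : ℕ} where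
  open FinPoset P

  IsInducedCopy : Family t n → (Fin k → Hypergrid t n) → Set
  IsInducedCopy 𝓕 φ =
      Injective _≡_ _≡_ φ
    × (∀ x → φ x ∈ 𝓕)
    × (∀ x y → (_≤ᴴ_ {t} {n} (φ x) (φ y)) ⇔ (x ⊑ y))

  ContainsInducedCopy : Family t n → Set
  ContainsInducedCopy 𝓕 = ∃[ φ ] IsInducedCopy 𝓕 φ

  InducedFree : Family t n → Set
  InducedFree 𝓕 = ¬ ContainsInducedCopy 𝓕

  InducedSaturated : Family t n → Set
  InducedSaturated 𝓕 =
    InducedFree 𝓕 × (∀ f → f ∉ 𝓕 → ContainsInducedCopy (𝓕 ∪ ⁅ f ⁆))

  private
    ⇔-dec : {A B : Set} → Dec A → Dec B → Dec (A ⇔ B)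
    ⇔-dec a? b? = map′ (λ (f , g) → mk⇔ f g)
      (λ e → Equivalence.to e , Equivalence.from e)
      ((a? →-dec b?) ×-dec (b? →-dec a?))

    isInducedCopy? : ∀ 𝓕 φ → Dec (IsInducedCopy 𝓕 φ)
    isInducedCopy? 𝓕 φ =
      map′ (λ h {x} {y} → h x y) (λ h x y → h {x} {y})
        (all? λ x → all? λ y → (φ x ≟ φ y) →-dec (x ≟ y))
      ×-dec all? (λ x → φ x ∈? 𝓕)
      ×-dec all? (λ x → all? λ y →
        ⇔-dec (all? λ i → _ Fin.≤? _) (x ⊑? y))

    isInducedCopy-resp : ∀ 𝓕 {φ ψ} → φ ≗ ψ → IsInducedCopy 𝓕 φ → IsInducedCopy 𝓕 ψ
    isInducedCopy-resp 𝓕 {φ} {ψ} e (inj , mem , ord) =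
        (λ {x} {y} p → inj (trans (e x) (trans p (sym (e y)))))
      , (λ x → subst (_∈ 𝓕) (e x) (mem x))
      , (λ x y → subst₂ (λ a b → (_≤ᴴ_ {t} {n} a b) ⇔ (x ⊑ y)) (e x) (e y) (ord x y))

  containsInducedCopy? : ∀ 𝓕 → Dec (ContainsInducedCopy 𝓕)
  containsInducedCopy? 𝓕 = map′
    (λ (c , h) → finToFun c , h)
    (λ (φ , h) → funToFin φ , isInducedCopy-resp 𝓕 (sym ∘ finToFun-funToFin φ) h)
    (any? λ c → isInducedCopy? 𝓕 (finToFun c))

  inducedSaturated? : ∀ 𝓕 → Dec (InducedSaturated 𝓕)
  inducedSaturated? 𝓕 =
    ¬? (containsInducedCopy? 𝓕)
    ×-dec all? λ f → ¬? (f ∈? 𝓕) →-dec containsInducedCopy? (𝓕 ∪ ⁅ f ⁆)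

-- The least m < b with Q m, or b if there is none.
least : {Q : ℕ → Set} → (∀ m → Dec (Q m)) → ℕ → ℕ
least Q? zero    = zero
least Q? (suc b) with Q? 0
... | yes _ = 0
... | no  _ = suc (least (Q? ∘ suc) b)

least-satisfies : {Q : ℕ → Set} (Q? : ∀ m → Dec (Q m)) (b : ℕ) →
                  ∀ m → m ≤ b → Q m → Q (least Q? b)
least-satisfies Q? zero    .zero   z≤n     q = q
least-satisfies Q? (suc b) m       m≤b     q with Q? 0
... | yes q₀ = q₀
least-satisfies Q? (suc b) zero    _       q | no ¬q₀ = ⊥-elim (¬q₀ q)
least-satisfies Q? (suc b) (suc m) (s≤s p) q | no _   =
  least-satisfies (Q? ∘ suc) b m p q

least-minimal : {Q : ℕ → Set} (Q? : ∀ m → Dec (Q m)) (b : ℕ) →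
                ∀ m → Q m → least Q? b ≤ m
least-minimal Q? zero    m       q = z≤n
least-minimal Q? (suc b) m       q with Q? 0
... | yes _ = z≤n
least-minimal Q? (suc b) zero    q | no ¬q₀ = ⊥-elim (¬q₀ q)
least-minimal Q? (suc b) (suc m) q | no _   = s≤s (least-minimal (Q? ∘ suc) b m q)

module _ {k : ℕ} (P : FinPoset k) (t n : ℕ) where

  HasSaturatedOfSize : ℕ → Set
  HasSaturatedOfSize m = ∃[ 𝓕 ] InducedSaturated P {t} {n} 𝓕 × ∣ 𝓕 ∣ ≡ m

  hasSaturatedOfSize? : ∀ m → Dec (HasSaturatedOfSize m)
  hasSaturatedOfSize? m =
    anySubset? λ 𝓕 → inducedSaturated? P {t} {n} 𝓕 ×-dec (∣ 𝓕 ∣ ℕ.≟ m)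

  -- The minimum size of an induced P-saturated family in the hypergrid; sizes
  -- are at most t ^ n.  For nonempty P the minimum exists (sat⋆-isMinimum).
  sat⋆ : ℕ
  sat⋆ = least hasSaturatedOfSize? (t ^ n)

  private
    extend : (d : ℕ) (𝓕 : Family t n) → t ^ n ≤ ∣ 𝓕 ∣ + d →
             InducedFree P {t} {n} 𝓕 → ∃[ 𝓖 ] InducedSaturated P {t} {n} 𝓖
    extend d 𝓕 bound free
      with any? (λ f → ¬? (f ∈? 𝓕) ×-dec ¬? (containsInducedCopy? P {t} {n} (𝓕 ∪ ⁅ f ⁆)))
    ... | no none = 𝓕 , free , λ f f∉𝓕 →
          decidable-stable (containsInducedCopy? P {t} {n} (𝓕 ∪ ⁅ f ⁆))
            (λ ¬c → none (f , f∉𝓕 , ¬c))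
    ... | yes (f , f∉𝓕 , free′) = step d bound
      where
      larger : ∣ 𝓕 ∣ < ∣ 𝓕 ∪ ⁅ f ⁆ ∣
      larger = p⊂q⇒∣p∣<∣q∣
        (p⊆p∪q ⁅ f ⁆ , f , q⊆p∪q 𝓕 ⁅ f ⁆ (x∈⁅x⁆ f) , f∉𝓕)
      step : (d : ℕ) → t ^ n ≤ ∣ 𝓕 ∣ + d → ∃[ 𝓖 ] InducedSaturated P {t} {n} 𝓖
      step zero b = ⊥-elim (ℕ.<-irrefl refl (ℕ.<-≤-trans larger
        (ℕ.≤-trans (∣p∣≤n (𝓕 ∪ ⁅ f ⁆)) (subst (t ^ n ≤_) (ℕ.+-identityʳ _) b))))
      step (suc d) b = extend d (𝓕 ∪ ⁅ f ⁆)
        (ℕ.≤-trans (subst (t ^ n ≤_) (ℕ.+-suc _ d) b) (ℕ.+-monoˡ-≤ d larger)) free′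

  saturatedExists : .{{NonZero k}} → ∃[ 𝓕 ] InducedSaturated P {t} {n} 𝓕
  saturatedExists = extend (t ^ n) ⊥ (ℕ.m≤n+m _ _) (∅-free k refl)
    where
    ∅-free : ∀ j → j ≡ k → .{{NonZero j}} → InducedFree P {t} {n} ⊥
    ∅-free (suc j) refl (φ , _ , mem , _) = ∉⊥ (mem Fin.zero)

  sat⋆-isMinimum : .{{NonZero k}} →
    HasSaturatedOfSize sat⋆ × (∀ 𝓕 → InducedSaturated P {t} {n} 𝓕 → sat⋆ ≤ ∣ 𝓕 ∣)
  sat⋆-isMinimum with 𝓕 , s ← saturatedExists =
      least-satisfies hasSaturatedOfSize? (t ^ n) ∣ 𝓕 ∣ (∣p∣≤n 𝓕) (𝓕 , s , refl)
    , λ 𝓖 s′ → least-minimal hasSaturatedOfSize? (t ^ n) ∣ 𝓖 ∣ (𝓖 , s′ , refl)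

-- f(n) = Ω(√n): for some constant c = p / q > 0, f(n) ≥ c √n for all large n.
-- Both sides are nonnegative, so the inequality is squared and cleared of
-- denominators; a positive real c may always be shrunk to a rational one.
IsΩ√n : (ℕ → ℕ) → Set
IsΩ√n f = ∃[ p ] ∃[ q ] ∃[ N ]
  0 < p × 0 < q × (∀ n → N ≤ n → p ^ 2 * n ≤ (q * f n) ^ 2)

{-# OPTIONS --safe #-}
-- Let 𝓕 be induced P-saturated.  For every coordinate i there are f, g ∈ 𝓕 such
-- that i is the only coordinate at which f exceeds g; since (f , g) determines i,
-- it follows that n ≤ ∣ 𝓕 ∣².
--
-- UCTP forbids a least element in P, so the zero function lies in 𝓕 and we may pick
-- f ∈ 𝓕 maximal subject to f(i) = 0.  Let h be f with its i-th value raised to 1.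
-- If no pair as above exists for i, then h ∉ 𝓕 and, by the choice of f, the elements
-- of 𝓕 other than f compare with f exactly as they compare with h.  Consider a copy
-- of P in 𝓕 ∪ {h}.  If it avoids f, then h can be replaced by f, contradicting
-- freeness.  If it uses f, then h covers f in the copy, and every other element
-- below h is below f, so the cover has no twin.
module Submission where

open import Defs
open import Level using (0ℓ)
open import Data.Nat using (ℕ; zero; suc; _+_; _*_; _^_; _≤_; z≤n; s≤s)
import Data.Nat.Properties as ℕ
open import Data.Fin as Fin using (Fin; zero; suc; toℕ; combine; funToFin)
open import Data.Fin.Induction using (po-noetherian)
open import Data.Fin.Properties using (_≟_; any?; all?; injective⇒≤; suc-injective; combine-injective; toℕ-injective; funToFin-finToFin; finToFun-funToFin)
open import Data.Fin.Subset using (Subset; _∈_; _∉_; ⁅_⁆; ∣_∣; inside; outside)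
open import Data.Fin.Subset.Properties using (_∈?_; x∈p∪q⁻; x∈⁅y⁆⇒x≡y)
open import Data.Product using (∃-syntax; _×_; _,_; proj₁; proj₂)
open import Data.Sum using (_⊎_; inj₁; inj₂)
open import Data.Vec using (_∷_; here; there)
open import Data.Vec.Functional using (updateAt)
open import Data.Vec.Functional.Properties using (updateAt-updates; updateAt-minimal)
open import Function using (_∘_; flip; const)
open import Function.Bundles using (_⇔_; mk⇔; module Equivalence)
open import Function.Definitions using (Injective)
open import Induction.WellFounded using (Acc; acc)
open import Relation.Binary using (Rel; IsDecPartialOrder)
import Relation.Binary.Construct.Flip.EqAndOrd as Flip
open import Relation.Binary.PropositionalEquality using (_≡_; _≢_; refl; sym; trans; cong; cong₂; subst; subst₂; isEquivalence)
open import Relation.Nullary using (¬_; Dec; yes; no; contradiction)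
open import Relation.Nullary.Decidable using (¬?; _×-dec_; _→-dec_; decidable-stable)

open Equivalence using (to; from)

-- Maximal elements, and counting by pairs of members.

module _ {m : ℕ} {_≼_ : Rel (Fin m) 0ℓ} (dpo : IsDecPartialOrder _≡_ _≼_) where
  open IsDecPartialOrder dpo using (isPartialOrder; _≤?_)

  -- Repeatedly passing to a strictly larger element with `Q` must stop, as a finite order has no
  -- infinite ascent. Applied to a flipped order it yields minimal elements.
  maximal-element : {Q : Fin m → Set} → (∀ a → Dec (Q a)) → ∀ a → Q a →
                    ∃[ b ] Q b × (∀ c → Q c → b ≼ c → b ≡ c)
  maximal-element {Q} Q? a = climb a (po-noetherian isPartialOrder a)
    where
    climb : ∀ a → Acc (λ x y → y ≼ x × y ≢ x) a → Q a →
            ∃[ b ] Q b × (∀ c → Q c → b ≼ c → b ≡ c)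
    climb a (acc rs) qa with any? (λ c → Q? c ×-dec (a ≤? c) ×-dec ¬? (a ≟ c))
    ... | yes (c , qc , a≼c , a≢c) = climb c (rs (a≼c , a≢c)) qc
    ... | no none = a , qa , λ c qc a≼c →
          decidable-stable (a ≟ c) (λ a≢c → none (c , qc , a≼c , a≢c))

rank : ∀ {m} {p : Subset m} {x} → x ∈ p → Fin ∣ p ∣
rank {p = inside  ∷ p} here        = zero
rank {p = inside  ∷ p} (there x∈p) = suc (rank x∈p)
rank {p = outside ∷ p} (there x∈p) = rank x∈p

rank-injective : ∀ {m} {p : Subset m} {x y} (x∈p : x ∈ p) (y∈p : y ∈ p) →
                 rank x∈p ≡ rank y∈p → x ≡ y
rank-injective {p = inside  ∷ p} here        here        _ = refl
rank-injective {p = inside  ∷ p} (there x∈p) (there y∈p) e =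
  cong suc (rank-injective x∈p y∈p (suc-injective e))
rank-injective {p = outside ∷ p} (there x∈p) (there y∈p) e =
  cong suc (rank-injective x∈p y∈p e)

-- Numbering the members of `p` by `rank` turns the witnessing pair of `i` into a code; as the pair
-- determines `i`, this coding is injective.
pairs-determine⇒≤-square : ∀ {m n} (p : Subset m) (R : Fin m → Fin m → Fin n → Set) →
  (∀ {x y i j} → R x y i → R x y j → i ≡ j) →
  (∀ i → ∃[ x ] ∃[ y ] x ∈ p × y ∈ p × R x y i) →
  n ≤ ∣ p ∣ * ∣ p ∣
pairs-determine⇒≤-square {n = n} p R functional witness = injective⇒≤ code-injective
  where
  code : Fin n → Fin (∣ p ∣ * ∣ p ∣)
  code i with _ , _ , x∈p , y∈p , _ ← witness i = combine (rank x∈p) (rank y∈p)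

  code-injective : Injective _≡_ _≡_ code
  code-injective {i} {j} e
    with x , y , x∈p , y∈p , r ← witness i | x′ , y′ , x′∈p , y′∈p , r′ ← witness j
    with e₁ , e₂ ← combine-injective (rank x∈p) (rank y∈p) (rank x′∈p) (rank y′∈p) e
    with refl ← rank-injective x∈p x′∈p e₁ | refl ← rank-injective y∈p y′∈p e₂
    = functional r r′

-- The pointwise order on the hypergrid.

module Grid (t n : ℕ) where

  infix 4 _≼_
  _≼_ : Rel (Hypergrid t n) 0ℓ
  _≼_ = _≤ᴴ_ {t} {n}

  at : Hypergrid t n → Fin n → Fin t
  at = _⟨_⟩ {t} {n}

  at-injective : ∀ {f g} → (∀ i → at f i ≡ at g i) → f ≡ g
  at-injective {f} {g} e = trans (sym (funToFin-finToFin {n} {t} f))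
    (trans (funToFin-cong e) (funToFin-finToFin {n} {t} g))
    where
    funToFin-cong : ∀ {n} {u v : Fin n → Fin t} → (∀ i → u i ≡ v i) → funToFin u ≡ funToFin v
    funToFin-cong {zero}  e = refl
    funToFin-cong {suc n} e =
      cong₂ (combine {t} {t ^ n}) (e zero) (funToFin-cong (e ∘ suc))

  ≼-isDecPartialOrder : IsDecPartialOrder _≡_ _≼_
  ≼-isDecPartialOrder = record
    { isPartialOrder = record
      { isPreorder = record
        { isEquivalence = isEquivalence
        ; reflexive     = λ { refl i → ℕ.≤-refl }
        ; trans         = λ f≼g g≼h i → ℕ.≤-trans (f≼g i) (g≼h i)
        }
      ; antisym = λ f≼g g≼f → at-injective λ i → toℕ-injective (ℕ.≤-antisym (f≼g i) (g≼f i))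
      }
    ; _≟_  = _≟_
    ; _≤?_ = λ f g → all? λ i → at f i Fin.≤? at g i
    }

  open IsDecPartialOrder ≼-isDecPartialOrder public using ()
    renaming (refl to ≼-refl; trans to ≼-trans)

  ExceedsOnlyAt : Hypergrid t n → Hypergrid t n → Fin n → Set
  ExceedsOnlyAt f g i = at g i Fin.< at f i × (∀ j → j ≢ i → at f j Fin.≤ at g j)

  exceedsOnlyAt? : ∀ f g i → Dec (ExceedsOnlyAt f g i)
  exceedsOnlyAt? f g i = (at g i Fin.<? at f i)
    ×-dec all? (λ j → ¬? (j ≟ i) →-dec (at f j Fin.≤? at g j))

  exceedsOnlyAt-functional : ∀ {f g i j} → ExceedsOnlyAt f g i → ExceedsOnlyAt f g j → i ≡ j
  exceedsOnlyAt-functional {i = i} {j} (g<f , _) (_ , f≤g) =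
    decidable-stable (i ≟ j) (λ i≢j → ℕ.<⇒≱ g<f (f≤g i i≢j))

-- The UCTP and saturated families.

module _ {k : ℕ} (P : FinPoset k) (uctp : UCTP P) where
  open FinPoset P
  private
    module P = IsDecPartialOrder isDecPartialOrder

    ⊒-isDecPartialOrder : IsDecPartialOrder _≡_ (flip _⊑_)
    ⊒-isDecPartialOrder = record
      { isPartialOrder = Flip.isPartialOrder P.isPartialOrder
      ; _≟_            = _≟_
      ; _≤?_           = flip _⊑?_
      }

  -- If `x` were least, an element `b` minimal among the others would cover `x`. A twin of `x` under
  -- `b` would then contradict the minimality of `b`.
  uctp⇒no-least : ∀ x y → x ≢ y → ¬ (∀ z → x ⊑ z)
  uctp⇒no-least x y x≢y least
    with b , b≢x , minimal ← maximal-element (⊒-isDecPartialOrder)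
           (λ z → ¬? (z ≟ x)) y (x≢y ∘ sym)
    with y′ , y′≢b , y′≢x , _ , y′⊑b , _ ← uctp b x
           ( b≢x , least b
           , λ (z , z≢b , z≢x , _ , z⊑b) → z≢b (sym (minimal z z≢x z⊑b)))
    = y′≢b (sym (minimal y′ y′≢x y′⊑b))

  module _ {t n : ℕ} (𝓕 : Family t n) (sat : InducedSaturated P {t} {n} 𝓕) where
    open Grid t n

    private
      free : InducedFree P {t} {n} 𝓕
      free = proj₁ sat

    -- Injectivity comes for free: equal images are comparable both ways, so antisymmetry in `P`
    -- applies.
    order-embedding⇒copy : (φ : Fin k → Hypergrid t n) → (∀ x → φ x ∈ 𝓕) →
                           (∀ x y → (φ x ≼ φ y) ⇔ (x ⊑ y)) → IsInducedCopy P {t} {n} 𝓕 φ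
    order-embedding⇒copy φ mem ord =
        (λ {x} {y} e → P.antisym
          (to (ord x y) (subst (φ x ≼_) e ≼-refl))
          (to (ord y x) (subst (_≼ φ x) e ≼-refl)))
      , mem , ord

    -- A copy missing `h` would lie in `𝓕`, which is free; by injectivity only one point is sent to
    -- `h`.
    copy-through : ∀ {h} → h ∉ 𝓕 →
      ∃[ φ ] ∃[ x ] φ x ≡ h × (∀ y → y ≢ x → φ y ∈ 𝓕) × (∀ y z → (φ y ≼ φ z) ⇔ (y ⊑ z))
    copy-through {h} h∉𝓕 with proj₂ sat h h∉𝓕
    ... | φ , inj , mem , ord with any? (λ x → φ x ≟ h)
    ...   | yes (x , refl) = φ , x , refl , others , ord
      where
      others : ∀ y → y ≢ x → φ y ∈ 𝓕
      others y y≢x with x∈p∪q⁻ 𝓕 ⁅ h ⁆ (mem y)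
      ... | inj₁ φy∈𝓕 = φy∈𝓕
      ... | inj₂ φy∈h = contradiction (inj (x∈⁅y⁆⇒x≡y h φy∈h)) y≢x
    ...   | no ¬h = contradiction (φ , order-embedding⇒copy φ all ord) free
      where
      all : ∀ y → φ y ∈ 𝓕
      all y with x∈p∪q⁻ 𝓕 ⁅ h ⁆ (mem y)
      ... | inj₁ φy∈𝓕 = φy∈𝓕
      ... | inj₂ φy∈h = contradiction (y , x∈⁅y⁆⇒x≡y h φy∈h) ¬h

    -- Otherwise some copy passes through `h`, and the preimage of `h` is a least element of `P`.
    least∈saturated : 2 ≤ k → ∀ h → (∀ g → h ≼ g) → h ∈ 𝓕
    least∈saturated 2≤k h h-least = decidable-stable (h ∈? 𝓕) λ h∉𝓕 →
      let φ , x , φx≡h , _ , ord = copy-through h∉𝓕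
          y , x≢y = another 2≤k x
      in uctp⇒no-least x y x≢y λ z →
           to (ord x z) (subst (_≼ φ z) (sym φx≡h) (h-least (φ z)))
      where
      another : ∀ {k} → 2 ≤ k → (x : Fin k) → ∃[ y ] x ≢ y
      another (s≤s (s≤s _)) zero    = suc zero , λ ()
      another (s≤s (s≤s _)) (suc _) = zero , λ ()

    module _ {f h} (f∈𝓕 : f ∈ 𝓕) (f≼h : f ≼ h)
             (below : ∀ g → g ∈ 𝓕 → g ≼ h → g ≼ f)
             (above : ∀ g → g ∈ 𝓕 → f ≼ g → f ≡ g ⊎ h ≼ g) where

      -- The converses of `below` and `above` follow from `f≼h` by transitivity, so apart from `f`
      -- itself no member of `𝓕` tells `f` and `h` apart.
      indistinguishable⇒∈ : h ∈ 𝓕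
      indistinguishable⇒∈ = decidable-stable (h ∈? 𝓕) impossible
        where
        impossible : h ∉ 𝓕 → _
        impossible h∉𝓕 with copy-through h∉𝓕
        ... | φ , x , refl , others , ord with any? (λ y → φ y ≟ f)
        ...   | yes (y , refl) = twinless (uctp x y (x≢y , y⊑x , nothing-between))
          where
          x≢y : x ≢ y
          x≢y refl = h∉𝓕 f∈𝓕

          y⊑x : y ⊑ x
          y⊑x = to (ord y x) f≼h

          ⊑x⇒⊑y : ∀ z → z ≢ x → z ⊑ x → z ⊑ y
          ⊑x⇒⊑y z z≢x z⊑x = to (ord z y) (below (φ z) (others z z≢x) (from (ord z x) z⊑x))

          nothing-between : ¬ (∃[ z ] z ≢ x × z ≢ y × y ⊑ z × z ⊑ x)
          nothing-between (z , z≢x , z≢y , y⊑z , z⊑x) =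
            z≢y (P.antisym (⊑x⇒⊑y z z≢x z⊑x) y⊑z)

          twinless : ¬ (∃[ y′ ] y′ ≢ x × y′ ≢ y × Covers P x y′)
          twinless (y′ , y′≢x , y′≢y , _ , y′⊑x , nothing) =
            -- The twin `y′` lies below `x`, hence below `y`, so `y` sits strictly between `y′` and
            -- `x`.
            nothing (y , x≢y ∘ sym , y′≢y ∘ sym , ⊑x⇒⊑y y′ y′≢x y′⊑x , y⊑x)
        -- The copy avoids `f`, so redirecting `x` from `h` to `f` gives a copy inside `𝓕`.
        ...   | no f∉φ = free (ψ , order-embedding⇒copy ψ ψ∈𝓕 ψ-ord)
          where
          ψ : Fin k → Hypergrid t n
          ψ = updateAt φ x (const f)

          ψx : ψ x ≡ f
          ψx = updateAt-updates x φ

          ψ≢x : ∀ {y} → y ≢ x → ψ y ≡ φ y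
          ψ≢x {y} = updateAt-minimal y x φ

          ψ∈𝓕 : ∀ y → ψ y ∈ 𝓕
          ψ∈𝓕 y with y ≟ x
          ... | yes refl = subst (_∈ 𝓕) (sym ψx) f∈𝓕
          ... | no y≢x   = subst (_∈ 𝓕) (sym (ψ≢x y≢x)) (others y y≢x)

          raise : ∀ y → y ≢ x → f ≼ φ y → φ x ≼ φ y
          raise y y≢x f≼φy with above (φ y) (others y y≢x) f≼φy
          ... | inj₁ f≡φy = contradiction (y , sym f≡φy) f∉φ
          ... | inj₂ h≼φy = h≼φy

          ψ-ord : ∀ y z → (ψ y ≼ ψ z) ⇔ (y ⊑ z)
          ψ-ord y z with y ≟ x | z ≟ x
          ... | yes refl | yes refl = mk⇔ (λ _ → P.refl) (λ _ → ≼-refl)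
          ... | yes refl | no z≢x rewrite ψx | ψ≢x z≢x = mk⇔
            (to (ord x z) ∘ raise z z≢x)
            (≼-trans f≼h ∘ from (ord x z))
          ... | no y≢x | yes refl rewrite ψx | ψ≢x y≢x = mk⇔
            (λ φy≼f → to (ord y x) (≼-trans φy≼f f≼h))
            (below (φ y) (others y y≢x) ∘ from (ord y x))
          ... | no y≢x | no z≢x rewrite ψ≢x y≢x | ψ≢x z≢x = ord y z

  -- A pair for every coordinate, and the bound.

  module _ {s n : ℕ} (𝓕 : Family (2 + s) n)
           (sat : InducedSaturated P {2 + s} {n} 𝓕) (2≤k : 2 ≤ k) where

    private
      t : ℕ
      t = 2 + s

    open Grid t n

    private
      𝟎 : Hypergrid t n
      𝟎 = funToFin {n} {t} (const zero)

      at𝟎 : ∀ i → at 𝟎 i ≡ zero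
      at𝟎 = finToFun-funToFin {n} {t} (const zero)

    saturated⇒pair : ∀ i → ∃[ f ] ∃[ g ] f ∈ 𝓕 × g ∈ 𝓕 × ExceedsOnlyAt f g i
    saturated⇒pair i = decidable-stable
      (any? λ f → any? λ g → (f ∈? 𝓕) ×-dec (g ∈? 𝓕) ×-dec exceedsOnlyAt? f g i)
      impossible
      where
      impossible : ¬ ¬ (∃[ f ] ∃[ g ] f ∈ 𝓕 × g ∈ 𝓕 × ExceedsOnlyAt f g i)
      impossible none
        with f , (f∈𝓕 , fi≡0) , maximal ← maximal-element ≼-isDecPartialOrder
               {Q = λ g → g ∈ 𝓕 × at g i ≡ zero}
               (λ g → (g ∈? 𝓕) ×-dec (at g i ≟ zero)) 𝟎
               ( least∈saturated 𝓕 sat 2≤k 𝟎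
                   (λ g j → subst (Fin._≤ at g j) (sym (at𝟎 j)) z≤n)
               , at𝟎 i)
        -- Indistinguishability forces `h` into `𝓕`, but then `(h , f)` is itself an excluded pair
        -- for `i`.
        = none (h , f , indistinguishable⇒∈ 𝓕 sat f∈𝓕 f≼h below above , f∈𝓕 , h-exceeds-f)
        where
        h : Hypergrid t n
        h = funToFin {n} {t} (updateAt (at f) i (const (suc zero)))

        hi : at h i ≡ suc zero
        hi = trans (finToFun-funToFin {n} {t} _ i) (updateAt-updates i (at f))

        h≢i : ∀ j → j ≢ i → at h j ≡ at f j
        h≢i j j≢i = trans (finToFun-funToFin {n} {t} _ j)
          (updateAt-minimal j i (at f) j≢i)

        h-exceeds-f : ExceedsOnlyAt h f i
        h-exceeds-f = subst₂ Fin._<_ (sym fi≡0) (sym hi) (s≤s z≤n)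
                    , λ j j≢i → ℕ.≤-reflexive (cong toℕ (h≢i j j≢i))

        f≼h : f ≼ h
        f≼h j with j ≟ i
        ... | yes refl = ℕ.<⇒≤ (proj₁ h-exceeds-f)
        ... | no j≢i   = ℕ.≤-reflexive (cong toℕ (sym (h≢i j j≢i)))

        below : ∀ g → g ∈ 𝓕 → g ≼ h → g ≼ f
        below g g∈𝓕 g≼h j with at g j Fin.≤? at f j
        ... | yes gj≤fj = gj≤fj
        ... | no  gj≰fj with j ≟ i
        ...   | no j≢i   = subst (at g j Fin.≤_) (h≢i j j≢i) (g≼h j)
        -- Here `g` exceeds `f` at `i`, while elsewhere it is bounded by `h`, which agrees with `f`
        -- there: `(g , f)` is an excluded pair.
        ...   | yes refl = contradiction
          ( g , f , g∈𝓕 , f∈𝓕 , ℕ.≰⇒> gj≰fj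
          , λ l l≢i → subst (at g l Fin.≤_) (h≢i l l≢i) (g≼h l)) none

        above : ∀ g → g ∈ 𝓕 → f ≼ g → f ≡ g ⊎ h ≼ g
        above g g∈𝓕 f≼g with at g i ≟ zero
        ... | yes gi≡0 = inj₁ (maximal g (g∈𝓕 , gi≡0) f≼g)
        ... | no  gi≢0 = inj₂ h≼g
          where
          h≼g : h ≼ g
          h≼g j with j ≟ i
          -- The value of `h` at `i` is 1, the smallest nonzero one, so any nonzero value of `g`
          -- suffices.
          ... | yes refl = subst (Fin._≤ at g i) (sym hi)
                             (ℕ.n≢0⇒n>0 (gi≢0 ∘ toℕ-injective))
          ... | no j≢i   = subst (Fin._≤ at g j) (sym (h≢i j j≢i)) (f≼g j)

    saturated⇒n≤∣𝓕∣² : n ≤ ∣ 𝓕 ∣ * ∣ 𝓕 ∣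
    saturated⇒n≤∣𝓕∣² = pairs-determine⇒≤-square 𝓕 (ExceedsOnlyAt)
      (λ {f} {g} → exceedsOnlyAt-functional {f} {g}) saturated⇒pair

mainTheorem3 : (t : ℕ) → 2 ≤ t → (k : ℕ) → 2 ≤ k → (P : FinPoset k) → UCTP P → IsΩ√n (λ n → sat⋆ P t n)
mainTheorem3 t@(suc (suc s)) (s≤s (s≤s _)) k@(suc _) 2≤k P uctp =
  -- The constant is 1 and the threshold 0: the bound holds for every `n`, applied to a saturated
  -- family of minimum size.
  1 , 1 , 0 , s≤s z≤n , s≤s z≤n , λ n _ → bound n (proj₁ (sat⋆-isMinimum P t n))
  where
  ≤-square : ∀ {n m l} → n ≤ l * l → l ≡ m → 1 ^ 2 * n ≤ (1 * m) ^ 2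
  ≤-square {n} {m} n≤m*m refl = begin
    1 ^ 2 * n    ≡⟨ ℕ.*-identityˡ n ⟩
    n            ≤⟨ n≤m*m ⟩
    m * m        ≡⟨ cong (m *_) (ℕ.*-identityʳ m) ⟨
    m ^ 2        ≡⟨ cong (_^ 2) (ℕ.*-identityˡ m) ⟨
    (1 * m) ^ 2  ∎
    where open ℕ.≤-Reasoning

  bound : ∀ n {m} → HasSaturatedOfSize P t n m → 1 ^ 2 * n ≤ (1 * m) ^ 2
  bound n (𝓕 , sat , size) = ≤-square (saturated⇒n≤∣𝓕∣² P uctp 𝓕 sat 2≤k) size
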